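{- Let $\mathcal{K}$ be a finite class of similar finite smooth idempotent algebras, let $\mathbb{A}_1,\mathbb{A}_2,\mathbb{A}_3\in\mathcal{K}$, and let $a_1b_1$, $a_2b_2$, and $a_3b_3$ be thin majority edges in $\mathbb{A}_1,\mathbb{A}_2,\mathbb{A}_3$, respectively. Then there is a term operation $g'$ satisfying the majority condition such that $g'(a_1,b_1,b_1)=b_1$, $g'(b_2,a_2,b_2)=b_2$, $g'(b_3,b_3,a_3)=b_3$. In particular, for any thin majority edge $ab$ there is an operation $g'$ satisfying the majority condition such that $g'(a,b,b)=g'(b,a,b)=g'(b,b,a)=b$.
   Context: $\mathsf{Sg}\{a,b\}$ is the subalgebra generated by $a,b$. For a congruence $\theta$ of $\mathsf{Sg}\{a,b\}$, $a/\theta$ is the $\theta$-block of $a$ and $f/\theta$ the operation induced by $f$ on the quotient. For an idempotent algebra, a pair $ab$ of distinct elements is a semilattice edge witnessed by a congruence $\theta$ of $\mathsf{Sg}\{a,b\}$ with $a/\theta\ne b/\theta$ if some binary term operation induces a semilattice operation on $\{a/\theta,b/\theta\}$; it is a majority edge witnessed by $\theta$ if some ternary term operation induces a majority operation on $\{a/\theta,b/\theta\}$ but no term operation induces a semilattice operation there. In each case $\{a/\theta,b/\theta\}$ is a thick edge of that type. An idempotent algebra is smooth if for every thick edge $\{a/\theta,b/\theta\}$ of semilattice or majority type the set $a/\theta\cup b/\theta$ is a subuniverse. Term operations are given by terms in the common signature of $\mathcal{K}$. A ternary term operation $g'$ satisfies the majority condition (with respect to $\mathcal{K}$) if $g'(x,g'(x,y,y),g'(x,y,y))=g'(x,y,y)$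 holds in every algebra of $\mathcal{K}$ and $g'$ (via $g'/\theta$) is a majority operation on every thick majority edge of every algebra from $\mathcal{K}$. A pair $ab$ of distinct elements of $\mathbb{A}\in\mathcal{K}$ is a thin majority edge (with respect to $\mathcal{K}$) if for any term operation $g'$ satisfying the majority condition, each of the subalgebras $\mathsf{Sg}\{a,g'(a,b,b)\}$, $\mathsf{Sg}\{a,g'(b,a,b)\}$, $\mathsf{Sg}\{a,g'(b,b,a)\}$ contains $b$. -}

module Defs where

open import Algebra.Core using (Op₂)
open import Data.Fin.Base using (Fin)
open import Data.Nat.Base using (ℕ)
open import Data.Product.Base using (_×_; ∃-syntax)
open import Data.Sum.Base using (_⊎_)
open import Data.Vec.Base using (Vec; []; _∷_; lookup; replicate; tabulate)
open import Data.Vec.Relation.Binary.Pointwise.Inductive using (Pointwise)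
open import Data.Vec.Relation.Unary.All using (All)
open import Function.Bundles using (_↔_)
open import Level using (0ℓ)
open import Relation.Binary.Core using (Rel)
open import Relation.Binary.PropositionalEquality.Core using (_≡_; _≢_)
open import Relation.Binary.Structures using (IsPartialEquivalence)
open import Relation.Nullary.Negation.Core using (¬_)
open import Relation.Unary using (Pred; _∈_; _∪_; ｛_｝)

record Signature : Set₁ where
  field
    Symbol : Set
    arity  : Symbol → ℕ

open Signature public

record Algebra (Σ : Signature) : Set₁ where
  field
    Carrier : Set
    ⟦_⟧     : (f : Symbol Σ) → Vec Carrier (arity Σ f) → Carrier

data Term (Σ : Signature) (n : ℕ) : Set where
  var : Fin n → Term Σ n
  app : (f : Symbol Σ) → (Fin (arity Σ f) → Term Σ n) → Term Σ n

module _ {Σ : Signature} (A : Algebra Σ) where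

  open Algebra A

  eval : ∀ {n} → Term Σ n → Vec Carrier n → Carrier
  eval (var i)    ρ = lookup ρ i
  eval (app f ts) ρ = ⟦ f ⟧ (tabulate λ i → eval (ts i) ρ)

  op₂ : Term Σ 2 → Op₂ Carrier
  op₂ t x y = eval t (x ∷ y ∷ [])

  op₃ : Term Σ 3 → Carrier → Carrier → Carrier → Carrier
  op₃ t x y z = eval t (x ∷ y ∷ z ∷ [])

  Finite : Set
  Finite = ∃[ n ] (Fin n ↔ Carrier)

  Idempotent : Set
  Idempotent = ∀ f x → ⟦ f ⟧ (replicate (arity Σ f) x) ≡ x

  IsSubuniverse : Pred Carrier 0ℓ → Set
  IsSubuniverse S = ∀ f {xs} → All S xs → S (⟦ f ⟧ xs)

  data Generated (X : Pred Carrier 0ℓ) : Pred Carrier 0ℓ where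
    generator : ∀ {x} → x ∈ X → Generated X x
    operation : ∀ f {xs} → All (Generated X) xs → Generated X (⟦ f ⟧ xs)

  Sg : Carrier → Carrier → Pred Carrier 0ℓ
  Sg a b = Generated (｛ a ｝ ∪ ｛ b ｝)

  -- Congruences of the subalgebra with universe S, as relations on the ambient
  -- carrier contained in S × S.  The θ-block of a ∈ S is then the predicate θ a.
  record IsCongruenceOn (S : Pred Carrier 0ℓ) (θ : Rel Carrier 0ℓ) : Set where
    field
      within               : ∀ {x y} → θ x y → x ∈ S × y ∈ S
      reflexive            : ∀ {x} → x ∈ S → θ x x
      isPartialEquivalence : IsPartialEquivalence θ
      compatible           : ∀ f {xs ys} → Pointwise θ xs ys →
                             θ (⟦ f ⟧ xs) (⟦ f ⟧ ys)

  -- The set {a/θ, b/θ} of blocks is handled through representatives, i.e. the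
  -- elements of a/θ ∪ b/θ, with θ in the role of equality of blocks.
  record InducesSemilattice (θ : Rel Carrier 0ℓ) (a b : Carrier)
                            (f : Term Σ 2) : Set where
    private
      B : Pred Carrier 0ℓ
      B = θ a ∪ θ b

      _∙_ : Op₂ Carrier
      _∙_ = op₂ f
    field
      closed : ∀ {x y} → x ∈ B → y ∈ B → (x ∙ y) ∈ B
      idem   : ∀ {x} → x ∈ B → θ (x ∙ x) x
      comm   : ∀ {x y} → x ∈ B → y ∈ B → θ (x ∙ y) (y ∙ x)
      assoc  : ∀ {x y z} → x ∈ B → y ∈ B → z ∈ B →
               θ ((x ∙ y) ∙ z) (x ∙ (y ∙ z))

  record InducesMajority (θ : Rel Carrier 0ℓ) (a b : Carrier)
                         (g : Term Σ 3) : Set where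
    private
      B : Pred Carrier 0ℓ
      B = θ a ∪ θ b

      m : Carrier → Carrier → Carrier → Carrier
      m = op₃ g
    field
      closed : ∀ {x y z} → x ∈ B → y ∈ B → z ∈ B → m x y z ∈ B
      maj₁   : ∀ {x y} → x ∈ B → y ∈ B → θ (m y x x) x
      maj₂   : ∀ {x y} → x ∈ B → y ∈ B → θ (m x y x) x
      maj₃   : ∀ {x y} → x ∈ B → y ∈ B → θ (m x x y) x

  -- Since θ is reflexive on Sg a b, ¬ θ a b (that is, a/θ ≠ b/θ) already
  -- forces a and b to be distinct.
  record SemilatticeEdge (θ : Rel Carrier 0ℓ) (a b : Carrier) : Set where
    field
      isCongruence : IsCongruenceOn (Sg a b) θ
      separated    : ¬ θ a b
      semilattice  : ∃[ f ] InducesSemilattice θ a b f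

  record MajorityEdge (θ : Rel Carrier 0ℓ) (a b : Carrier) : Set where
    field
      isCongruence  : IsCongruenceOn (Sg a b) θ
      separated     : ¬ θ a b
      majority      : ∃[ g ] InducesMajority θ a b g
      noSemilattice : ¬ (∃[ f ] InducesSemilattice θ a b f)

  Smooth : Set₁
  Smooth = ∀ θ a b → SemilatticeEdge θ a b ⊎ MajorityEdge θ a b →
           IsSubuniverse (θ a ∪ θ b)

-- A finite class of similar algebras is a family indexed by Fin k.
module _ {Σ : Signature} {k : ℕ} (𝒦 : Fin k → Algebra Σ) where

  open Algebra using (Carrier)

  record MajorityCondition (g : Term Σ 3) : Set₁ where
    field
      identity : ∀ i (x y : Carrier (𝒦 i)) → let m = op₃ (𝒦 i) g in
                 m x (m x y y) (m x y y) ≡ m x y y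
      majority : ∀ i θ a b → MajorityEdge (𝒦 i) θ a b →
                 InducesMajority (𝒦 i) θ a b g

  record ThinMajorityEdge (i : Fin k) (a b : Carrier (𝒦 i)) : Set₁ where
    field
      distinct : a ≢ b
      thin     : ∀ g → MajorityCondition g → let m = op₃ (𝒦 i) g in
                 b ∈ Sg (𝒦 i) a (m a b b) ×
                 b ∈ Sg (𝒦 i) a (m b a b) ×
                 b ∈ Sg (𝒦 i) a (m b b a)

{-# OPTIONS --safe #-}
module Submission where

-- By smoothness the two blocks of a thick majority edge form a two-element idempotent algebra, and
-- as it has no semilattice term operation, all its binary term operations are projections.  Hence
-- operations g and h, each a majority on some of the edges, combine into one that is a majority on
-- all of these; finiteness bounds the number of combinations.  Replacing g(x,y,z) repeatedly by
-- g(x, g(x,y,z), g(x,y,z)) makes y ↦ g(x,y,y) an idempotent map, which gives the identity of the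
-- majority condition.  Finally, thinness provides a binary term p with p(a, g(a,b,b)) = b.  Replacing x
-- by p(x, g(x,y,z)) in g(x,y,z) sends (a,b,b) to b, and preserves majorities because on a thick
-- edge p(x, g(x,y,z)) is x or the majority value; the other two positions are treated likewise.

open import Algebra.Core using (Op₂)
open import Algebra.Definitions using (Associative; Commutative)
open import Axiom.ExcludedMiddle using (ExcludedMiddle)
open import Data.Bool.Base using (Bool; true; false; if_then_else_; _∧_; _∨_)
open import Data.Bool.Properties using (∧-assoc; ∧-comm; ∧-idem; ∨-assoc; ∨-comm; ∨-idem)
open import Data.Fin.Base using (Fin; zero; suc; toℕ; finToFun; funToFin)
open import Data.Fin.Patterns using (0F; 1F; 2F)
open import Data.Fin.Properties using (_≟_; pigeonhole; finToFun-funToFin)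
open import Data.List.Base as List using (List; []; _∷_; allFin; cartesianProduct; concatMap)
open import Data.List.Membership.Propositional using (_∈_; lose)
open import Data.List.Membership.Propositional.Properties
  using (∈-map⁺; ∈-concatMap⁺; ∈-cartesianProduct⁺; ∈-allFin)
open import Data.List.Relation.Unary.All as ListAll using ([]; _∷_)
open import Data.Nat.Base using (ℕ; zero; suc; _+_; _*_; _∸_; _^_)
open import Data.Nat.GeneralisedArithmetic using (fold; fold-+)
open import Data.Nat.Properties
  using (*-comm; +-suc; m∸n+n≡m; m≤m*n; n≤1+n; m≤n⇒∃[o]m+o≡n; n<1+n; ≤-trans; +-comm)
open import Data.Product.Base using (_×_; _,_; proj₁; proj₂; ∃; ∃-syntax)
open import Data.Sum.Base using (_⊎_; inj₁; inj₂)
open import Data.Vec.Base using (Vec; []; _∷_; lookup; map; replicate; tabulate; _[_]≔_)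
open import Data.Vec.Properties
  using ([]≔-idempotent; []≔-lookup; lookup-map; lookup-replicate; lookup∘update;
         lookup∘update′; map-[]≔; map-replicate; tabulate-cong; tabulate-∘;
         tabulate∘lookup)
open import Data.Vec.Relation.Binary.Pointwise.Inductive as Pointwise using ()
open import Data.Vec.Relation.Unary.All using (All; []; _∷_)
open import Data.Vec.Relation.Unary.All.Properties using (lookup⁺; tabulate⁺)
open import Function.Base using (_∘_)
open import Function.Bundles using (Inverse; _↔_)
open import Level using (0ℓ)
open import Relation.Binary.Core using (Rel)
open import Relation.Binary.PropositionalEquality
  using (_≡_; _≢_; refl; sym; trans; cong; cong₂; subst; module ≡-Reasoning)
open import Relation.Binary.Structures using (IsPartialEquivalence)
open import Relation.Nullary.Decidable.Core using (yes; no; does)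
open import Relation.Nullary.Negation.Core using (¬_; contradiction)
open import Relation.Unary using (Pred; _∪_)
open import Defs

open ≡-Reasoning

-- Constant tuples with one deviating entry.

module _ {X : Set} where

  -- For length 3 these tuples reduce definitionally to (a,b,b), (b,a,b) and (b,b,a), so one index
  -- `j` treats the three positions alike and the final equations need no conversion.
  outlier : ∀ {n} → Fin n → X → X → Vec X n
  outlier j a b = replicate _ b [ j ]≔ a

  outlier-erase : ∀ {n} (j : Fin n) (a b : X) → outlier j a b [ j ]≔ b ≡ replicate n b
  outlier-erase {n} j a b = begin
    outlier j a b [ j ]≔ b                             ≡⟨ []≔-idempotent (replicate n b) j ⟩
    replicate n b [ j ]≔ b
      ≡⟨ cong (replicate n b [ j ]≔_) (lookup-replicate j b) ⟨
    replicate n b [ j ]≔ lookup (replicate n b) j      ≡⟨ []≔-lookup (replicate n b) j ⟩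
    replicate n b                                      ∎

  lookup-outlier : ∀ {n} {i j : Fin n} → i ≢ j → (a b : X) → lookup (outlier j a b) i ≡ b
  lookup-outlier {n} {i} i≢j a b =
    trans (lookup∘update′ i≢j (replicate n b) a) (lookup-replicate i b)

  outlier-keep : ∀ {n} {i j : Fin n} → i ≢ j → (a b : X) →
                 outlier j a b [ i ]≔ b ≡ outlier j a b
  outlier-keep {i = i} {j} i≢j a b = begin
    outlier j a b [ i ]≔ b
      ≡⟨ cong (outlier j a b [ i ]≔_) (lookup-outlier i≢j a b) ⟨
    outlier j a b [ i ]≔ lookup (outlier j a b) i       ≡⟨ []≔-lookup (outlier j a b) i ⟩
    outlier j a b                                       ∎

all-replicate : ∀ {X : Set} {P : Pred X 0ℓ} {b} n → P b → All P (replicate n b)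
all-replicate zero    pb = []
all-replicate (suc n) pb = pb ∷ all-replicate n pb

all-outlier : ∀ {X : Set} {P : Pred X 0ℓ} {n} (j : Fin n) {a b} → P a → P b → All P (outlier j a b)
all-outlier zero    pa pb = pa ∷ all-replicate _ pb
all-outlier (suc j) pa pb = pb ∷ all-outlier j pa pb

map-outlier : ∀ {X Y : Set} {n} (f : X → Y) (j : Fin n) (a b : X) →
              map f (outlier j a b) ≡ outlier j (f a) (f b)
map-outlier {n = n} f j a b =
  trans (map-[]≔ f (replicate n b) j) (cong (_[ j ]≔ f a) (map-replicate f b n))

tabulate-const : ∀ {X : Set} n (x : X) → tabulate {n = n} (λ _ → x) ≡ replicate n x
tabulate-const zero    x = refl
tabulate-const (suc n) x = cong (x ∷_) (tabulate-const n x)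

-- Iterates of a self-map on a finite set.

fold-fixed : ∀ {X : Set} (f : X → X) e {x} → fold x f e ≡ x → ∀ m → fold x f (m * e) ≡ x
fold-fixed f e     fixed zero    = refl
fold-fixed f e {x} fixed (suc m) = begin
  fold x f (e + m * e)        ≡⟨ fold-+ x f e ⟩
  fold (fold x f (m * e)) f e ≡⟨ cong (λ y → fold y f e) (fold-fixed f e fixed m) ⟩
  fold x f e                  ≡⟨ fixed ⟩
  x                           ∎

-- N is a period of f from the N-th iterate of y onwards.
Settles : {X : Set} → (X → X) → X → ℕ → Set
Settles f y N = fold (fold y f N) f N ≡ fold y f N

-- The point reached after `N` steps is fixed by `N` further steps, so every positive multiple of
-- `N` ends at that same point. Passing to multiples is what allows one exponent for several maps.
settles-* : ∀ {X : Set} (f : X → X) y N m → Settles f y N → Settles f y (suc m * N)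
settles-* f y N m settled = begin
  fold (fold y f (suc m * N)) f (suc m * N) ≡⟨ cong (λ z → fold z f (suc m * N)) same ⟩
  fold (fold y f N) f (suc m * N)           ≡⟨ fold-fixed f N settled (suc m) ⟩
  fold y f N                                ≡⟨ same ⟨
  fold y f (suc m * N)                      ∎
  where
  same : fold y f (suc m * N) ≡ fold y f N
  same = begin
    fold y f (N + m * N)        ≡⟨ cong (fold y f) (+-comm N (m * N)) ⟩
    fold y f (m * N + N)        ≡⟨ fold-+ y f (m * N) ⟩
    fold (fold y f N) f (m * N) ≡⟨ fold-fixed f N settled m ⟩
    fold y f N                  ∎

fold-comm : ∀ {X : Set} (f : X → X) (x : X) m n →
            fold (fold x f m) f n ≡ fold (fold x f n) f m
fold-comm f x m n = begin
  fold (fold x f m) f n ≡⟨ fold-+ x f n ⟨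
  fold x f (n + m)      ≡⟨ cong (fold x f) (+-comm n m) ⟩
  fold x f (m + n)      ≡⟨ fold-+ x f m ⟩
  fold (fold x f n) f m ∎

-- Two of the first n + 1 iterates of `y` coincide, and the distance between them is a period.
eventually-periodic : ∀ {X : Set} {n} (to : X → Fin n) → (∀ {x y} → to x ≡ to y → x ≡ y) →
                      (f : X → X) (y : X) →
                      ∃[ s ] ∃[ e ] fold (fold y f s) f (suc e) ≡ fold y f s
eventually-periodic {n = n} to to-injective f y
  with i , j , i<j , same ← pigeonhole (n<1+n n) (λ i → to (fold y f (toℕ i)))
  -- The strict inequality unfolds to suc i + o = j, so the period is `suc o` and in particular
  -- positive.
  with o , i+o≡j ← m≤n⇒∃[o]m+o≡n i<j = toℕ i , o , (begin
  fold (fold y f (toℕ i)) f (suc o) ≡⟨ fold-comm f y (toℕ i) (suc o) ⟩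
  fold (fold y f (suc o)) f (toℕ i) ≡⟨ fold-+ y f (toℕ i) ⟨
  fold y f (toℕ i + suc o)          ≡⟨ cong (fold y f) (trans (+-suc (toℕ i) o) i+o≡j) ⟩
  fold y f (toℕ j)                  ≡⟨ to-injective same ⟨
  fold y f (toℕ i)                  ∎)

settles : ∀ {X : Set} {n} (to : X → Fin n) → (∀ {x y} → to x ≡ to y → x ≡ y) →
          (f : X → X) (y : X) → ∃[ N ] Settles f y (suc N)
settles to to-injective f y
  with s , e , periodic ← eventually-periodic to to-injective f y =
  -- The predecessor of `suc s * suc e`, a multiple of the period `suc e` that exceeds the preperiod
  -- `s`.
  e + s * suc e , fold-fixed f (suc e) fixed (suc s)
  where
  N = suc s * suc e
  r = N ∸ s

  reached : fold y f N ≡ fold (fold y f s) f r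
  reached = begin
    fold y f N            ≡⟨ cong (fold y f) (m∸n+n≡m (≤-trans (n≤1+n s) (m≤m*n (suc s) (suc e)))) ⟨
    fold y f (r + s)      ≡⟨ fold-+ y f r ⟩
    fold (fold y f s) f r ∎

  fixed : fold (fold y f N) f (suc e) ≡ fold y f N
  fixed = begin
    fold (fold y f N) f (suc e)              ≡⟨ cong (λ z → fold z f (suc e)) reached ⟩
    fold (fold (fold y f s) f r) f (suc e)   ≡⟨ fold-comm f (fold y f s) r (suc e) ⟩
    fold (fold (fold y f s) f (suc e)) f r   ≡⟨ cong (λ z → fold z f r) periodic ⟩
    fold (fold y f s) f r                    ≡⟨ reached ⟨
    fold y f N                               ∎

settle-together : ∀ {X : Set} {Y : X → Set} (f : ∀ x → Y x → Y x) (y : ∀ x → Y x) →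
                  (∀ x → ∃[ N ] Settles (f x) (y x) (suc N)) →
                  (xs : List X) → ∃[ N ] ListAll.All (λ x → Settles (f x) (y x) (suc N)) xs
settle-together f y each []       = 0 , []
settle-together f y each (x ∷ xs) with each x | settle-together f y each xs
... | M , here | N , there =
  -- The predecessor of `suc M * suc N`, a common multiple of the two exponents.
  N + M * suc N ,
  subst (Settles (f x) (y x)) (*-comm (suc N) (suc M)) (settles-* (f x) (y x) (suc M) N here) ∷
  ListAll.map (λ {x} → settles-* (f x) (y x) (suc N) M) there

-- Constructions on terms.

module _ {Σ : Signature} where

  _⟪_⟫ : ∀ {m n} → Term Σ m → Vec (Term Σ n) m → Term Σ n
  var i    ⟪ σ ⟫ = lookup σ i
  app f ts ⟪ σ ⟫ = app f λ i → ts i ⟪ σ ⟫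

  infixl 8 _⟪_⟫

  vars : ∀ {n} → Vec (Term Σ n) n
  vars = tabulate var

  -- The second variable stands at position `j` and the first one everywhere else, so this is the
  -- first projection exactly when `h` ignores a deviating entry at `j`.
  minor : ∀ {n} → Term Σ n → Fin n → Term Σ 2
  minor h j = h ⟪ outlier j (var 1F) (var 0F) ⟫

  -- Where binary terms are projections, this is the first projection if h is a majority operation,
  -- and the second one otherwise.
  switch : Term Σ 3 → Term Σ 2
  switch h = minor h 0F ⟪ minor h 1F ⟪ minor h 2F ∷ var 1F ∷ [] ⟫ ∷ var 1F ∷ [] ⟫

  -- Where binary terms are projections, this acts as `h` if `h` is a majority operation and as `g`
  -- otherwise.
  join : Term Σ 3 → Term Σ 3 → Term Σ 3
  join h g = switch h ⟪ h ∷ g ∷ [] ⟫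

  -- The index is shifted by one: `iterate g n` evaluates at (x,y,y) to n + 1 applications of z ↦
  -- g(x,z,z) to y. This matches the `suc N` in `settles`.
  iterate : Term Σ 3 → ℕ → Term Σ 3
  iterate g zero    = g
  iterate g (suc n) = g ⟪ var 0F ∷ iterate g n ∷ iterate g n ∷ [] ⟫

  correct : ∀ {n} → Fin n → Term Σ 2 → Term Σ n → Term Σ n
  correct j p g = g ⟪ vars [ j ]≔ p ⟪ var j ∷ g ∷ [] ⟫ ⟫

-- Evaluation of terms in a single algebra.

module _ {Σ : Signature} (A : Algebra Σ) where

  open Algebra A

  eval-⟪⟫ : ∀ {m n} (t : Term Σ m) (σ : Vec (Term Σ n) m) (ρ : Vec Carrier n) →
            eval A (t ⟪ σ ⟫) ρ ≡ eval A t (map (λ s → eval A s ρ) σ)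
  eval-⟪⟫ (var i)    σ ρ = sym (lookup-map i _ σ)
  eval-⟪⟫ (app f ts) σ ρ = cong ⟦ f ⟧ (tabulate-cong λ i → eval-⟪⟫ (ts i) σ ρ)

  eval-idem : Idempotent A → ∀ {n} (t : Term Σ n) x → eval A t (replicate n x) ≡ x
  eval-idem idem (var i)    x = lookup-replicate i x
  eval-idem idem {n} (app f ts) x = begin
    ⟦ f ⟧ (tabulate λ i → eval A (ts i) (replicate n x))
      ≡⟨ cong ⟦ f ⟧ (tabulate-cong λ i → eval-idem idem (ts i) x) ⟩
    ⟦ f ⟧ (tabulate λ _ → x)                             ≡⟨ cong ⟦ f ⟧ (tabulate-const _ x) ⟩
    ⟦ f ⟧ (replicate (arity Σ f) x)                      ≡⟨ idem f x ⟩
    x                                                    ∎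

  eval-closed : ∀ {S : Pred Carrier 0ℓ} → IsSubuniverse A S →
                ∀ {n} (t : Term Σ n) {ρ} → All S ρ → S (eval A t ρ)
  eval-closed sub (var i)    ρ∈S = lookup⁺ ρ∈S i
  eval-closed sub (app f ts) ρ∈S = sub f (tabulate⁺ λ i → eval-closed sub (ts i) ρ∈S)

  module _ {a b : Carrier} where

    mutual

      -- A derivation of membership in `Sg` is itself a term tree. This turns the thinness of an
      -- edge into a binary term that can be substituted elsewhere.
      Sg-term : ∀ {x} → Sg A a b x → ∃[ t ] op₂ A t a b ≡ x
      Sg-term (generator (inj₁ a≡x)) = var 0F , a≡x
      Sg-term (generator (inj₂ b≡x)) = var 1F , b≡x
      Sg-term (operation f xs∈Sg) with Sg-terms xs∈Sg
      ... | ts , ts≡xs = app f ts , cong ⟦ f ⟧ ts≡xs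

      Sg-terms : ∀ {n} {xs : Vec Carrier n} → All (Sg A a b) xs →
                 ∃ λ (ts : Fin n → Term Σ 2) → tabulate (λ i → op₂ A (ts i) a b) ≡ xs
      Sg-terms []             = (λ ()) , refl
      Sg-terms (x∈Sg ∷ xs∈Sg) with Sg-term x∈Sg | Sg-terms xs∈Sg
      ... | t , t≡x | ts , ts≡xs = (λ { zero → t ; (suc i) → ts i }) , cong₂ _∷_ t≡x ts≡xs

  IgnoresOutlier : ∀ {n} → Term Σ n → Fin n → Carrier → Carrier → Set
  IgnoresOutlier g j a b = eval A g (outlier j a b) ≡ b

  NearUnanimity : ∀ {n} → Term Σ n → Set
  NearUnanimity g = ∀ j a b → IgnoresOutlier g j a b

  IsFirst IsSecond : Term Σ 2 → Set
  IsFirst  t = ∀ x y → op₂ A t x y ≡ x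
  IsSecond t = ∀ x y → op₂ A t x y ≡ y

  -- The form in which the absence of a semilattice operation on a thick majority edge enters the
  -- term manipulations.
  BinaryProjections : Set
  BinaryProjections = ∀ t → IsFirst t ⊎ IsSecond t

  op-minor : ∀ {n} (h : Term Σ n) j x y → op₂ A (minor h j) x y ≡ eval A h (outlier j y x)
  op-minor h j x y =
    trans (eval-⟪⟫ h _ _) (cong (eval A h) (map-outlier _ j (var 1F) (var 0F)))

  op-switch : ∀ h x y → op₂ A (switch h) x y ≡
              op₂ A (minor h 0F) (op₂ A (minor h 1F) (op₂ A (minor h 2F) x y) y) y
  op-switch h x y = trans (eval-⟪⟫ (minor h 0F) _ _)
    (cong (λ z → op₂ A (minor h 0F) z y) (eval-⟪⟫ (minor h 1F) _ _))

  minor-first : ∀ {n} (h : Term Σ n) j → IsFirst (minor h j) → ∀ a b → IgnoresOutlier h j a b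
  minor-first h j first a b = trans (sym (op-minor h j b a)) (first b a)

  switch-first : ∀ h → NearUnanimity h → IsFirst (switch h)
  switch-first h nu x y = begin
    op₂ A (switch h) x y
      ≡⟨ op-switch h x y ⟩
    op₂ A (minor h 0F) (op₂ A (minor h 1F) (op₂ A (minor h 2F) x y) y) y ≡⟨ first 0F _ y ⟩
    op₂ A (minor h 1F) (op₂ A (minor h 2F) x y) y                                ≡⟨ first 1F _ y ⟩
    op₂ A (minor h 2F) x y
      ≡⟨ first 2F x y ⟩
    x                                                                                  ∎
    where
    first : ∀ j → IsFirst (minor h j)
    first j x y = trans (op-minor h j x y) (nu j y x)

  -- Take the outermost minor that is a second projection: it returns `y`, and the first projections
  -- around it pass this value on. If there is none, `h` ignores an outlier in each of its
  -- positions.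
  switch-second : BinaryProjections → ∀ h → NearUnanimity h ⊎ IsSecond (switch h)
  switch-second proj h with proj (minor h 0F)
  ... | inj₂ second₀ = inj₂ λ x y → trans (op-switch h x y) (second₀ _ y)
  ... | inj₁ first₀ with proj (minor h 1F)
  ...   | inj₂ second₁ = inj₂ λ x y → trans (op-switch h x y) (trans (first₀ _ y) (second₁ _ y))
  ...   | inj₁ first₁ with proj (minor h 2F)
  ...     | inj₂ second₂ = inj₂ λ x y →
              trans (op-switch h x y) (trans (first₀ _ y) (trans (first₁ _ y) (second₂ x y)))
  ...     | inj₁ first₂ = inj₁ λ where
              0F → minor-first h 0F first₀
              1F → minor-first h 1F first₁
              2F → minor-first h 2F first₂

  join-nuˡ : ∀ h g → NearUnanimity h → NearUnanimity (join h g)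
  join-nuˡ h g nu j a b =
    trans (eval-⟪⟫ (switch h) _ _) (trans (switch-first h nu _ _) (nu j a b))

  -- Either the switch selects `g`, or `h` is near-unanimous itself and selecting `h` does no harm.
  join-nuʳ : BinaryProjections → ∀ h g → NearUnanimity g → NearUnanimity (join h g)
  join-nuʳ proj h g nu with switch-second proj h
  ... | inj₁ nu-h   = join-nuˡ h g nu-h
  ... | inj₂ second = λ j a b → trans (eval-⟪⟫ (switch h) _ _) (trans (second _ _) (nu j a b))

  eval-iterate : ∀ g n ρ → eval A (iterate g (suc n)) ρ ≡
                 op₃ A g (lookup ρ 0F) (eval A (iterate g n) ρ) (eval A (iterate g n) ρ)
  eval-iterate g n ρ = eval-⟪⟫ g _ ρ

  iterate-fold : ∀ g n x y → op₃ A (iterate g n) x y y ≡ fold y (λ z → op₃ A g x z z) (suc n)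
  iterate-fold g zero    x y = refl
  iterate-fold g (suc n) x y =
    trans (eval-iterate g n _) (cong (λ z → op₃ A g x z z) (iterate-fold g n x y))

  iterate-identity : ∀ g n x y → Settles (λ z → op₃ A g x z z) y (suc n) →
                     let m = op₃ A (iterate g n) in m x (m x y y) (m x y y) ≡ m x y y
  iterate-identity g n x y settled = begin
    m x (m x y y) (m x y y)              ≡⟨ iterate-fold g n x (m x y y) ⟩
    fold (m x y y) p (suc n)             ≡⟨ cong (λ z → fold z p (suc n)) (iterate-fold g n x y) ⟩
    fold (fold y p (suc n)) p (suc n)    ≡⟨ settled ⟩
    fold y p (suc n)                     ≡⟨ iterate-fold g n x y ⟨
    m x y y                              ∎
    where
    m = op₃ A (iterate g n)
    p = λ z → op₃ A g x z z

  eval-correct : ∀ {n} j p (g : Term Σ n) ρ →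
                 eval A (correct j p g) ρ ≡
                 eval A g (ρ [ j ]≔ op₂ A p (lookup ρ j) (eval A g ρ))
  eval-correct j p g ρ = begin
    eval A (correct j p g) ρ                        ≡⟨ eval-⟪⟫ g _ ρ ⟩
    eval A g (map ⟦_⟧ρ (vars [ j ]≔ s))             ≡⟨ cong (eval A g) (map-[]≔ ⟦_⟧ρ vars j) ⟩
    eval A g (map ⟦_⟧ρ vars [ j ]≔ ⟦ s ⟧ρ)
      ≡⟨ cong (λ v → eval A g (v [ j ]≔ ⟦ s ⟧ρ)) map-vars ⟩
    eval A g (ρ [ j ]≔ ⟦ s ⟧ρ)
      ≡⟨ cong (λ x → eval A g (ρ [ j ]≔ x)) (eval-⟪⟫ p _ ρ) ⟩
    eval A g (ρ [ j ]≔ op₂ A p (lookup ρ j) ⟦ g ⟧ρ) ∎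
    where
    ⟦_⟧ρ = λ t → eval A t ρ
    s    = p ⟪ var j ∷ g ∷ [] ⟫

    map-vars : map ⟦_⟧ρ vars ≡ ρ
    map-vars = trans (sym (tabulate-∘ ⟦_⟧ρ var)) (tabulate∘lookup ρ)

  -- Iteration and correction in an idempotent algebra.

  module _ (idem : Idempotent A) where

    -- By induction the two inner copies return `b`. The outer `g` then sees (a,b,b), which is the
    -- given tuple, if `j` is the first position, and a constant tuple otherwise.
    iterate-ignores : ∀ g n {j a b} → IgnoresOutlier g j a b → IgnoresOutlier (iterate g n) j a b
    iterate-ignores g zero        ignores = ignores
    iterate-ignores g (suc n) {j} {a} {b} ignores = begin
      eval A (iterate g (suc n)) (outlier j a b) ≡⟨ eval-iterate g n (outlier j a b) ⟩
      op₃ A g (lookup (outlier j a b) 0F) u u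
        ≡⟨ cong (λ z → op₃ A g (lookup (outlier j a b) 0F) z z) (iterate-ignores g n ignores) ⟩
      op₃ A g (lookup (outlier j a b) 0F) b b    ≡⟨ last j ignores ⟩
      b                                          ∎
      where
      u = eval A (iterate g n) (outlier j a b)

      last : ∀ j → IgnoresOutlier g j a b → op₃ A g (lookup (outlier j a b) 0F) b b ≡ b
      last zero    ignores = ignores
      last (suc j) _       = eval-idem idem g b

    -- The term `p` replaces the deviating `a` by `b`, so `g` is applied to a constant tuple.
    correct-ignores : ∀ {n} (g : Term Σ n) p {j a b} →
                      op₂ A p a (eval A g (outlier j a b)) ≡ b →
                      IgnoresOutlier (correct j p g) j a b
    correct-ignores {n} g p {j} {a} {b} p≡b = begin
      eval A (correct j p g) ρ                             ≡⟨ eval-correct j p g ρ ⟩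
      eval A g (ρ [ j ]≔ op₂ A p (lookup ρ j) (eval A g ρ))
        ≡⟨ cong (λ x → eval A g (ρ [ j ]≔ op₂ A p x (eval A g ρ))) (lookup∘update j (replicate n b) a) ⟩
      eval A g (ρ [ j ]≔ op₂ A p a (eval A g ρ))
        ≡⟨ cong (λ x → eval A g (ρ [ j ]≔ x)) p≡b ⟩
      eval A g (ρ [ j ]≔ b)
        ≡⟨ cong (eval A g) (outlier-erase j a b) ⟩
      eval A g (replicate n b)                              ≡⟨ eval-idem idem g b ⟩
      b                                                     ∎
      where ρ = outlier j a b

    -- Position `i` already carries `b`, and so does the value of `g`; hence `p` returns `b` and the
    -- correction leaves the tuple as it is.
    correct-keeps : ∀ {n} (g : Term Σ n) p {i j a b} → i ≢ j →
                    IgnoresOutlier g j a b → IgnoresOutlier (correct i p g) j a b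
    correct-keeps g p {i} {j} {a} {b} i≢j ignores = begin
      eval A (correct i p g) ρ                              ≡⟨ eval-correct i p g ρ ⟩
      eval A g (ρ [ i ]≔ op₂ A p (lookup ρ i) (eval A g ρ))
        ≡⟨ cong₂ (λ x y → eval A g (ρ [ i ]≔ op₂ A p x y)) (lookup-outlier i≢j a b) ignores ⟩
      eval A g (ρ [ i ]≔ op₂ A p b b)
        ≡⟨ cong (λ x → eval A g (ρ [ i ]≔ x)) (eval-idem idem p b) ⟩
      eval A g (ρ [ i ]≔ b)
        ≡⟨ cong (eval A g) (outlier-keep i≢j a b) ⟩
      eval A g ρ                                            ≡⟨ ignores ⟩
      b                                                     ∎
      where ρ = outlier j a b

    -- Only a correction at the deviating position needs an argument. If `p` is the second
    -- projection, it inserts the value of `g`, which is the majority value; if it is the first,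
    -- nothing changes.
    correct-nu : BinaryProjections → ∀ {n} (g : Term Σ n) i p →
                 NearUnanimity g → NearUnanimity (correct i p g)
    correct-nu proj g i p nu j a b with i ≟ j
    ... | no i≢j   = correct-keeps g p i≢j (nu j a b)
    ... | yes refl with proj p
    ...   | inj₂ second = correct-ignores g p (trans (second _ _) (nu i a b))
    ...   | inj₁ first  = begin
      eval A (correct i p g) ρ                              ≡⟨ eval-correct i p g ρ ⟩
      eval A g (ρ [ i ]≔ op₂ A p (lookup ρ i) (eval A g ρ))
        ≡⟨ cong (λ x → eval A g (ρ [ i ]≔ x)) (first _ _) ⟩
      eval A g (ρ [ i ]≔ lookup ρ i)                        ≡⟨ cong (eval A g) ([]≔-lookup ρ i) ⟩
      eval A g ρ                                            ≡⟨ nu i a b ⟩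
      b                                                     ∎
      where ρ = outlier i a b

-- One operation for a finite list of algebras.

common-near-unanimity :
  ExcludedMiddle 0ℓ → {Σ : Signature} (As : List (Algebra Σ)) →
  ∃[ g ] ListAll.All
    (λ A → BinaryProjections A → (∃[ h ] NearUnanimity A {3} h) → NearUnanimity A g) As
common-near-unanimity em []       = var 0F , []
common-near-unanimity em (A ∷ As)
  with common-near-unanimity em As | em {∃[ h ] NearUnanimity A {3} h}
... | g , nu | no none      = g , (λ _ h → contradiction h none) ∷ nu
-- Joining with `h` gains the algebra `A` and loses none of the algebras in `As` that `g` serves.
... | g , nu | yes (h , nu-h) =
  join h g ,
  (λ _ _ → join-nuˡ A h g nu-h) ∷
  ListAll.map (λ {B} nu-g proj some → join-nuʳ B proj h g (nu-g proj some)) nu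

-- Idempotent binary operations on two elements.

module _ {f : Op₂ Bool} (idem : ∀ x → f x x ≡ x) where

  private
    agrees : (g : Op₂ Bool) → (∀ x → g x x ≡ x) →
             f true false ≡ g true false → f false true ≡ g false true →
             ∀ x y → f x y ≡ g x y
    agrees g g-idem p q true  true  = trans (idem true) (sym (g-idem true))
    agrees g g-idem p q true  false = p
    agrees g g-idem p q false true  = q
    agrees g g-idem p q false false = trans (idem false) (sym (g-idem false))

    transport : (g : Op₂ Bool) → Commutative _≡_ g → Associative _≡_ g →
                (∀ x y → f x y ≡ g x y) → Commutative _≡_ f × Associative _≡_ f
    transport g comm assoc f≗g =
      (λ x y → trans (f≗g x y) (trans (comm x y) (sym (f≗g y x)))) ,
      (λ x y z → begin
        f (f x y) z ≡⟨ f≗g (f x y) z ⟩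
        g (f x y) z ≡⟨ cong (λ w → g w z) (f≗g x y) ⟩
        g (g x y) z ≡⟨ assoc x y z ⟩
        g x (g y z) ≡⟨ cong (g x) (f≗g y z) ⟨
        g x (f y z) ≡⟨ f≗g x (f y z) ⟨
        f x (f y z) ∎)

  -- Idempotence fixes the diagonal. The two remaining values leave four operations: both
  -- projections, disjunction and conjunction.
  idempotent-op₂-cases : ((∀ x y → f x y ≡ x) ⊎ (∀ x y → f x y ≡ y)) ⊎
                         (Commutative _≡_ f × Associative _≡_ f)
  idempotent-op₂-cases with f true false in p | f false true in q
  ... | true  | false = inj₁ (inj₁ (agrees (λ x _ → x) (λ _ → refl) p q))
  ... | false | true  = inj₁ (inj₂ (agrees (λ _ y → y) (λ _ → refl) p q))
  ... | true  | true  = inj₂ (transport _∨_ ∨-comm ∨-assoc (agrees _∨_ ∨-idem p q))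
  ... | false | false = inj₂ (transport _∧_ ∧-comm ∧-assoc (agrees _∧_ ∧-idem p q))

-- The two-element algebra of blocks.

module _ {Σ : Signature} (A : Algebra Σ) (a b : Algebra.Carrier A) where

  open Algebra A

  representative : Bool → Carrier
  representative v = if v then a else b

  -- For the blocks a/θ and b/θ, coded as true and false, this is the quotient of a/θ ∪ b/θ by θ
  -- when c sends each element to its block.
  blockAlgebra : (Carrier → Bool) → Algebra Σ
  blockAlgebra c = record { Carrier = Bool ; ⟦_⟧ = λ f vs → c (⟦ f ⟧ (map representative vs)) }

  -- A block map recovered from its code agrees with the original pointwise, and this carries over
  -- to all term operations.
  blockAlgebra-cong : ∀ {c c′} → (∀ x → c x ≡ c′ x) → ∀ {n} (t : Term Σ n) vs →
                      eval (blockAlgebra c) t vs ≡ eval (blockAlgebra c′) t vs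
  blockAlgebra-cong c≗c′ (var i)    vs = refl
  blockAlgebra-cong {c} c≗c′ (app f ts) vs =
    trans (cong (c ∘ ⟦ f ⟧ ∘ map representative)
                (tabulate-cong λ i → blockAlgebra-cong c≗c′ (ts i) vs))
          (c≗c′ _)

module BlockAlgebra
  (em : ExcludedMiddle 0ℓ) {Σ : Signature} (A : Algebra Σ) (idem : Idempotent A)
  {θ : Rel (Algebra.Carrier A) 0ℓ} {a b : Algebra.Carrier A}
  (isCongruence : IsCongruenceOn A (Sg A a b) θ) (separated : ¬ θ a b)
  (subuniverse : IsSubuniverse A (θ a ∪ θ b)) where

  open Algebra A
  open IsCongruenceOn isCongruence
  open IsPartialEquivalence isPartialEquivalence renaming (sym to θ-sym; trans to θ-trans)

  B : Pred Carrier 0ℓ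
  B = θ a ∪ θ b

  -- Elements outside both blocks also receive `false`. Smoothness keeps the values of terms on `B`
  -- inside `B`, where the coding is faithful.
  block : Carrier → Bool
  block x = does (em {θ a x})

  rep : Bool → Carrier
  rep = representative A a b

  𝔹 : Algebra Σ
  𝔹 = blockAlgebra A a b block

  rep∈B : ∀ v → B (rep v)
  rep∈B true  = inj₁ (reflexive (generator (inj₁ refl)))
  rep∈B false = inj₂ (reflexive (generator (inj₂ refl)))

  block-rep : ∀ v → block (rep v) ≡ v
  block-rep true with em {θ a a}
  ... | yes _    = refl
  ... | no ¬θaa  = contradiction (reflexive (generator (inj₁ refl))) ¬θaa
  block-rep false with em {θ a b}
  ... | yes θab  = contradiction θab separated
  ... | no _     = refl

  θ-rep : ∀ {x} → B x → θ x (rep (block x))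
  θ-rep {x} x∈B with em {θ a x}
  ... | yes θax = θ-sym θax
  θ-rep {x} (inj₁ θax) | no ¬θax = contradiction θax ¬θax
  θ-rep {x} (inj₂ θbx) | no _    = θ-sym θbx

  θ⇒block≡ : ∀ {x y} → θ x y → block x ≡ block y
  θ⇒block≡ {x} {y} θxy with em {θ a x} | em {θ a y}
  ... | yes _   | yes _   = refl
  ... | no _    | no _    = refl
  ... | yes θax | no ¬θay = contradiction (θ-trans θax θxy) ¬θay
  ... | no ¬θax | yes θay = contradiction (θ-trans θay (θ-sym θxy)) ¬θax

  block≡⇒θ : ∀ {x y} → B x → B y → block x ≡ block y → θ x y
  block≡⇒θ {x} {y} x∈B y∈B same =
    θ-trans (θ-rep x∈B) (subst (λ v → θ (rep v) y) (sym same) (θ-sym (θ-rep y∈B)))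

  -- Each argument of a basic operation lies in `B` by smoothness, hence is θ-related to the
  -- representative of its block; compatibility of θ allows the replacement.
  block-eval : ∀ {n} (t : Term Σ n) {ρ} → All B ρ → block (eval A t ρ) ≡ eval 𝔹 t (map block ρ)
  block-eval (var i)    {ρ} ρ∈B = sym (lookup-map i block ρ)
  block-eval (app f ts) {ρ} ρ∈B = begin
    block (⟦ f ⟧ (tabulate e))
      ≡⟨ θ⇒block≡ (compatible f (Pointwise.tabulate⁺ related)) ⟩
    block (⟦ f ⟧ (tabulate (rep ∘ e′)))    ≡⟨ cong (block ∘ ⟦ f ⟧) (tabulate-∘ rep e′) ⟩
    block (⟦ f ⟧ (map rep (tabulate e′)))  ∎
    where
    e = λ i → eval A (ts i) ρ
    e′ = λ i → eval 𝔹 (ts i) (map block ρ)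

    related : ∀ i → θ (e i) (rep (e′ i))
    related i = subst (λ v → θ (e i) (rep v)) (block-eval (ts i) ρ∈B)
                      (θ-rep (eval-closed A subuniverse (ts i) ρ∈B))

  𝔹-idem : Idempotent 𝔹
  𝔹-idem f v = begin
    block (⟦ f ⟧ (map rep (replicate _ v))) ≡⟨ cong (block ∘ ⟦ f ⟧) (map-replicate rep v _) ⟩
    block (⟦ f ⟧ (replicate _ (rep v)))     ≡⟨ cong block (idem f (rep v)) ⟩
    block (rep v)                           ≡⟨ block-rep v ⟩
    v                                       ∎

  -- A commutative and associative operation on the two blocks pulls back along `block` to a
  -- semilattice operation on the edge, which is excluded. Only projections remain.
  noSemilattice⇒projections : ¬ (∃[ f ] InducesSemilattice A θ a b f) → BinaryProjections 𝔹
  noSemilattice⇒projections none f with idempotent-op₂-cases {op₂ 𝔹 f} (eval-idem 𝔹 𝔹-idem f)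
  ... | inj₁ projection     = projection
  ... | inj₂ (comm , assoc) = contradiction (f , induces) none
    where
    closed : ∀ {x y} → B x → B y → B (op₂ A f x y)
    closed x∈B y∈B = eval-closed A subuniverse f (x∈B ∷ y∈B ∷ [])

    block-op₂ : ∀ {x y} → B x → B y → block (op₂ A f x y) ≡ op₂ 𝔹 f (block x) (block y)
    block-op₂ x∈B y∈B = block-eval f (x∈B ∷ y∈B ∷ [])

    induces : InducesSemilattice A θ a b f
    induces = record
      { closed = closed
      ; idem   = λ {x} x∈B → block≡⇒θ (closed x∈B x∈B) x∈B (cong block (eval-idem A idem f x))
      ; comm   = λ x∈B y∈B → block≡⇒θ (closed x∈B y∈B) (closed y∈B x∈B)
          (trans (block-op₂ x∈B y∈B) (trans (comm _ _) (sym (block-op₂ y∈B x∈B))))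
      ; assoc  = λ {x} {y} {z} x∈B y∈B z∈B →
          block≡⇒θ (closed (closed x∈B y∈B) z∈B) (closed x∈B (closed y∈B z∈B)) (begin
            block (op₂ A f (op₂ A f x y) z)                      ≡⟨ block-op₂ (closed x∈B y∈B) z∈B ⟩
            op₂ 𝔹 f (block (op₂ A f x y)) (block z)
              ≡⟨ cong (λ v → op₂ 𝔹 f v (block z)) (block-op₂ x∈B y∈B) ⟩
            op₂ 𝔹 f (op₂ 𝔹 f (block x) (block y)) (block z)      ≡⟨ assoc _ _ _ ⟩
            op₂ 𝔹 f (block x) (op₂ 𝔹 f (block y) (block z))
              ≡⟨ cong (op₂ 𝔹 f (block x)) (block-op₂ y∈B z∈B) ⟨
            op₂ 𝔹 f (block x) (block (op₂ A f y z))              ≡⟨ block-op₂ x∈B (closed y∈B z∈B) ⟨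
            block (op₂ A f x (op₂ A f y z))                      ∎)
      }

  block-outlier : ∀ {n} (g : Term Σ n) j {x y} → B x → B y →
                  block (eval A g (outlier j x y)) ≡ eval 𝔹 g (outlier j (block x) (block y))
  block-outlier g j {x} {y} x∈B y∈B =
    trans (block-eval g (all-outlier j x∈B y∈B)) (cong (eval 𝔹 g) (map-outlier block j x y))

  majority⇒nu : ∀ g → InducesMajority A θ a b g → NearUnanimity 𝔹 g
  majority⇒nu g maj j v w = begin
    eval 𝔹 g (outlier j v w)
      ≡⟨ cong₂ (λ x y → eval 𝔹 g (outlier j x y)) (block-rep v) (block-rep w) ⟨
    eval 𝔹 g (outlier j (block (rep v)) (block (rep w)))
      ≡⟨ block-outlier g j (rep∈B v) (rep∈B w) ⟨
    block (eval A g (outlier j (rep v) (rep w)))                ≡⟨ θ⇒block≡ (near j) ⟩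
    block (rep w)                                               ≡⟨ block-rep w ⟩
    w                                                           ∎
    where
    open InducesMajority maj
    near : ∀ j → θ (eval A g (outlier j (rep v) (rep w))) (rep w)
    near 0F = maj₁ (rep∈B w) (rep∈B v)
    near 1F = maj₂ (rep∈B w) (rep∈B v)
    near 2F = maj₃ (rep∈B w) (rep∈B v)

  -- Closure comes from smoothness, so only the majority equations are read off from the blocks.
  nu⇒majority : ∀ g → NearUnanimity 𝔹 g → InducesMajority A θ a b g
  nu⇒majority g nu = record
    { closed = λ x∈B y∈B z∈B → eval-closed A subuniverse g (x∈B ∷ y∈B ∷ z∈B ∷ [])
    ; maj₁   = near 0F
    ; maj₂   = near 1F
    ; maj₃   = near 2F
    }
    where
    near : ∀ j {x y} → B x → B y → θ (eval A g (outlier j y x)) x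
    near j x∈B y∈B = block≡⇒θ (eval-closed A subuniverse g (all-outlier j y∈B x∈B)) x∈B
      (trans (block-outlier g j y∈B x∈B) (nu j _ _))

-- Listing finite sets and their two-valued maps.

module _ {X : Set} {n : ℕ} (enum : Fin n ↔ X) where

  open Inverse enum

  elements : List X
  elements = List.map to (allFin n)

  ∈-elements : ∀ x → x ∈ elements
  ∈-elements x = subst (_∈ elements) (strictlyInverseˡ x) (∈-map⁺ to (∈-allFin (from x)))

  from-injective : ∀ {x y} → from x ≡ from y → x ≡ y
  from-injective {x} {y} same = begin
    x           ≡⟨ strictlyInverseˡ x ⟨
    to (from x) ≡⟨ cong to same ⟩
    to (from y) ≡⟨ strictlyInverseˡ y ⟩
    y           ∎

  -- A map to `Bool` is coded by the binary digits of a number, with digit `0F` standing for `true`.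
  -- This makes all such maps available as a finite list.
  decode : Fin (2 ^ n) → X → Bool
  decode code x = does (finToFun code (from x) ≟ 0F)

  encode : (X → Bool) → Fin (2 ^ n)
  encode c = funToFin λ i → if c (to i) then 0F else 1F

  decode-encode : ∀ c x → decode (encode c) x ≡ c x
  decode-encode c x = begin
    does (finToFun (encode c) (from x) ≟ 0F)
      ≡⟨ cong (λ i → does (i ≟ 0F)) (finToFun-funToFin {n} _ (from x)) ⟩
    does ((if c (to (from x)) then 0F else 1F) ≟ 0F)
      ≡⟨ cong (λ y → does ((if c y then 0F else 1F) ≟ 0F)) (strictlyInverseˡ x) ⟩
    does ((if c x then 0F else 1F) ≟ 0F)              ≡⟨ bit (c x) ⟩
    c x                                               ∎
    where
    bit : ∀ v → does (_≟_ {2} (if v then 0F else 1F) 0F) ≡ v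
    bit true  = refl
    bit false = refl

module _ {k : ℕ} {Y : Fin k → Set} (lists : ∀ i → List (Y i)) where

  union : List (∃ Y)
  union = concatMap (λ i → List.map (i ,_) (lists i)) (allFin k)

  ∈-union : ∀ {i y} → y ∈ lists i → (i , y) ∈ union
  ∈-union {i} y∈ =
    ∈-concatMap⁺ (λ i → List.map (i ,_) (lists i)) (lose (∈-allFin i) (∈-map⁺ (i ,_) y∈))

-- Majority operations and thin edges in a finite class.

module FiniteClass
  (em : ExcludedMiddle 0ℓ) {Σ : Signature} {k : ℕ} (𝒦 : Fin k → Algebra Σ)
  (finite : ∀ i → Finite (𝒦 i)) (idem : ∀ i → Idempotent (𝒦 i))
  (smooth : ∀ i → Smooth (𝒦 i)) where

  Carrierᵢ : Fin k → Set
  Carrierᵢ i = Algebra.Carrier (𝒦 i)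

  enum : ∀ i → Fin (proj₁ (finite i)) ↔ Carrierᵢ i
  enum i = proj₂ (finite i)

  module Edge {i θ a b} (edge : MajorityEdge (𝒦 i) θ a b) where
    open MajorityEdge edge public
    open BlockAlgebra em (𝒦 i) (idem i) isCongruence separated (smooth i θ a b (inj₂ edge)) public

    projections : BinaryProjections 𝔹
    projections = noSemilattice⇒projections noSemilattice

  MajorityOnEdges : Term Σ 3 → Set₁
  MajorityOnEdges g = ∀ i θ a b (edge : MajorityEdge (𝒦 i) θ a b) → NearUnanimity (Edge.𝔹 edge) g

  -- Congruences are arbitrary relations and are not listed. The block algebra depends only on two
  -- elements and a two-valued map, and there are finitely many such data.
  BlockCode : Fin k → Set
  BlockCode i = Carrierᵢ i × Carrierᵢ i × Fin (2 ^ proj₁ (finite i))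

  blockCodes : ∀ i → List (BlockCode i)
  blockCodes i =
    cartesianProduct (elements (enum i)) (cartesianProduct (elements (enum i)) (allFin _))

  decodeBlocks : ∃ BlockCode → Algebra Σ
  decodeBlocks (i , a , b , code) = blockAlgebra (𝒦 i) a b (decode (enum i) code)

  majority-on-edges : ∃ MajorityOnEdges
  majority-on-edges = g , nu
    where
    -- The list also contains algebras that come from no edge; for this reason the combined
    -- operation is conditional on the properties of each algebra separately.
    common = common-near-unanimity em (List.map decodeBlocks (union blockCodes))
    g      = proj₁ common

    nu : MajorityOnEdges g
    nu i θ a b edge j v w = begin
      eval 𝔹 g (outlier j v w)  ≡⟨ same g _ ⟨
      eval 𝔹′ g (outlier j v w)
        ≡⟨ ListAll.lookup (proj₂ common) listed projections′ (h , nu-h) j v w ⟩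
      w                         ∎
      where
      open Edge edge
      -- The code of the actual block map: its algebra is in the list and has the same term
      -- operations as `𝔹`.
      entry = i , a , b , encode (enum i) block
      𝔹′    = decodeBlocks entry

      same : ∀ {n} (t : Term Σ n) vs → eval 𝔹′ t vs ≡ eval 𝔹 t vs
      same = blockAlgebra-cong (𝒦 i) a b (decode-encode (enum i) block)

      listed : 𝔹′ ∈ List.map decodeBlocks (union blockCodes)
      listed = ∈-map⁺ decodeBlocks (∈-union blockCodes
        (∈-cartesianProduct⁺ (∈-elements (enum i) a) (∈-cartesianProduct⁺ (∈-elements (enum i) b) (∈-allFin _))))

      projections′ : BinaryProjections 𝔹′
      projections′ t with projections t
      ... | inj₁ first  = inj₁ λ x y → trans (same t _) (first x y)
      ... | inj₂ second = inj₂ λ x y → trans (same t _) (second x y)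

      h = proj₁ majority

      nu-h : NearUnanimity 𝔹′ h
      nu-h j v w = trans (same h _) (majority⇒nu h (proj₂ majority) j v w)

  pairs : ∀ i → List (Carrierᵢ i × Carrierᵢ i)
  pairs i = cartesianProduct (elements (enum i)) (elements (enum i))

  Preserves : (g g′ : Term Σ 3) → Fin 3 → Set
  Preserves g g′ j = ∀ {i a b} → IgnoresOutlier (𝒦 i) g j a b → IgnoresOutlier (𝒦 i) g′ j a b

  module _ (g : Term Σ 3) where

    -- Indexing by pairs lets the first component determine the map and the second its starting
    -- point, so a single exponent settles every orbit.
    diagonal : (p : ∃ λ i → Carrierᵢ i × Carrierᵢ i) → Carrierᵢ (proj₁ p) → Carrierᵢ (proj₁ p)
    diagonal (i , x , _) z = op₃ (𝒦 i) g x z z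

    start : (p : ∃ λ i → Carrierᵢ i × Carrierᵢ i) → Carrierᵢ (proj₁ p)
    start (_ , _ , y) = y

    -- Abstract, since unfolding the pigeonhole search makes with-abstraction over N intractable.
    abstract

      settle-everywhere : ∃[ N ] ∀ i (x y : Carrierᵢ i) → Settles (λ z → op₃ (𝒦 i) g x z z) y (suc N)
      settle-everywhere
        with N , settled ← settle-together diagonal start
               (λ p → settles (Inverse.from (enum (proj₁ p))) (from-injective (enum (proj₁ p))) (diagonal p) (start p))
               (union pairs) =
        N , λ i x y → ListAll.lookup settled
          (∈-union pairs (∈-cartesianProduct⁺ (∈-elements (enum i) x) (∈-elements (enum i) y)))

  iterate-majority : ∀ g N → MajorityOnEdges g → MajorityOnEdges (iterate g N)
  iterate-majority g N nu i θ a b edge j v w = iterate-ignores 𝔹 𝔹-idem g N {j} {v} {w} (nu i θ a b edge j v w)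
    where open Edge edge

  iterate-preserves : ∀ g N j → Preserves g (iterate g N) j
  iterate-preserves g N j {i} {a} {b} = iterate-ignores (𝒦 i) (idem i) g N {j} {a} {b}

  -- Iteration up to the common exponent supplies the identity and keeps every equation for an
  -- outlier that `g` already satisfies.
  regularise : ∀ g → MajorityOnEdges g →
               ∃[ g′ ] (MajorityCondition 𝒦 g′ × MajorityOnEdges g′ × ∀ j → Preserves g g′ j)
  regularise g nu with N , settled ← settle-everywhere g =
    iterate g N ,
    record
      { identity = λ i x y → iterate-identity (𝒦 i) g N x y (settled i x y)
      ; majority = λ i θ a b edge → Edge.nu⇒majority edge (iterate g N) (nu′ N i θ a b edge)
      } ,
    nu′ N ,
    iterate-preserves g N
    where
    nu′ : ∀ N → MajorityOnEdges (iterate g N)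
    nu′ N = iterate-majority g N nu

  thin-Sg : ∀ {i a b g} → ThinMajorityEdge 𝒦 i a b → MajorityCondition 𝒦 g →
            ∀ j → Sg (𝒦 i) a (eval (𝒦 i) g (outlier j a b)) b
  thin-Sg thin-edge condition j with ThinMajorityEdge.thin thin-edge _ condition
  thin-Sg _ _ 0F | b∈ , _ , _ = b∈
  thin-Sg _ _ 1F | _ , b∈ , _ = b∈
  thin-Sg _ _ 2F | _ , _ , b∈ = b∈

  -- Thinness speaks only of operations with the majority condition, so `g` is regularised before
  -- `p` is extracted. The identity is not carried through the correction, and the result records
  -- majority on edges alone.
  improve : ∀ j {i a b} → ThinMajorityEdge 𝒦 i a b → ∀ g → MajorityOnEdges g →
            ∃[ g′ ] (MajorityOnEdges g′ × IgnoresOutlier (𝒦 i) g′ j a b ×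
                     ∀ j′ → j ≢ j′ → Preserves g g′ j′)
  improve j {i} thin-edge g nu
    with g₁ , condition , nu₁ , preserves ← regularise g nu
    with p , p≡b ← Sg-term (𝒦 i) (thin-Sg thin-edge condition j) =
    correct j p g₁ ,
    (λ i θ a b edge → let open Edge edge in correct-nu 𝔹 𝔹-idem projections g₁ j p (nu₁ i θ a b edge)) ,
    correct-ignores (𝒦 i) (idem i) g₁ p p≡b ,
    λ j′ j≢j′ {i′} ignores → correct-keeps (𝒦 i′) (idem i′) g₁ p j≢j′ (preserves j′ ignores)

  -- The positions are corrected in turn. Each correction preserves the equations at the other
  -- positions in every algebra of the class, so the three edges may lie in different algebras.
  thin-edges-together : ∀ {i₁ i₂ i₃ a₁ b₁ a₂ b₂ a₃ b₃} →
    ThinMajorityEdge 𝒦 i₁ a₁ b₁ → ThinMajorityEdge 𝒦 i₂ a₂ b₂ → ThinMajorityEdge 𝒦 i₃ a₃ b₃ →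
    ∃[ g ] (MajorityCondition 𝒦 g × IgnoresOutlier (𝒦 i₁) g 0F a₁ b₁ ×
            IgnoresOutlier (𝒦 i₂) g 1F a₂ b₂ × IgnoresOutlier (𝒦 i₃) g 2F a₃ b₃)
  thin-edges-together thin₁ thin₂ thin₃
    with g₀ , nu₀ ← majority-on-edges
    with g₁ , nu₁ , eq₁ , _ ← improve 0F thin₁ g₀ nu₀
    with g₂ , nu₂ , eq₂ , keep₂ ← improve 1F thin₂ g₁ nu₁
    with g₃ , nu₃ , eq₃ , keep₃ ← improve 2F thin₃ g₂ nu₂
    -- A last regularisation restores the identity and keeps the three equations.
    with g₄ , condition , _ , keep₄ ← regularise g₃ nu₃ =
    g₄ , condition ,
    keep₄ 0F (keep₃ 0F (λ ()) (keep₂ 0F (λ ()) eq₁)) ,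
    keep₄ 1F (keep₃ 1F (λ ()) eq₂) ,
    keep₄ 2F eq₃

lemma4p5 : ExcludedMiddle 0ℓ →
    (Σ : Signature) (k : ℕ) (𝒦 : Fin k → Algebra Σ) →
    (∀ i → Finite (𝒦 i)) → (∀ i → Idempotent (𝒦 i)) → (∀ i → Smooth (𝒦 i)) →
    (∀ i₁ i₂ i₃ a₁ b₁ a₂ b₂ a₃ b₃ →
    ThinMajorityEdge 𝒦 i₁ a₁ b₁ →
    ThinMajorityEdge 𝒦 i₂ a₂ b₂ →
    ThinMajorityEdge 𝒦 i₃ a₃ b₃ →
    ∃[ g ] (MajorityCondition 𝒦 g ×
    op₃ (𝒦 i₁) g a₁ b₁ b₁ ≡ b₁ ×
    op₃ (𝒦 i₂) g b₂ a₂ b₂ ≡ b₂ ×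
    op₃ (𝒦 i₃) g b₃ b₃ a₃ ≡ b₃)) ×
    (∀ i a b →
    ThinMajorityEdge 𝒦 i a b →
    ∃[ g ] (MajorityCondition 𝒦 g ×
    op₃ (𝒦 i) g a b b ≡ b ×
    op₃ (𝒦 i) g b a b ≡ b ×
    op₃ (𝒦 i) g b b a ≡ b))
lemma4p5 em Σ k 𝒦 finite idem smooth =
  (λ _ _ _ _ _ _ _ _ _ → thin-edges-together) ,
  (λ _ _ _ thin → thin-edges-together thin thin thin)
  where open FiniteClass em 𝒦 finite idem smooth
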